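{- Let $\mathbb{C}$ be a regular category with finite limits and finite colimits, let $V$ be an object of $\mathbb{C}$, let $\Sigma = V + \Sigma' \colon \mathbb{C}\to\mathbb{C}$ where $\Sigma'$ admits free algebras, and let $B\colon \mathbb{C}^{\mathsf{op}}\times\mathbb{C}\to\mathbb{C}$ be a functor. Let $\rho$ be a $V$-pointed higher-order GSOS law of $\Sigma$ over $B$. Suppose that $\Sigma$ preserves reflexive coequalizers and that $B$ preserves monomorphisms (a morphism $(f,g)$ of $\mathbb{C}^{\mathsf{op}}\times\mathbb{C}$ is monic iff $f$ is epic in $\mathbb{C}$ and $g$ is monic in $\mathbb{C}$). Suppose moreover that the endofunctor $B(\mu\Sigma,-)$ has a final coalgebra $(Z,\zeta)$, and let $\mathrm{coit}\,\iota^\clubsuit\colon \mu\Sigma\to Z$ be the unique $B(\mu\Sigma,-)$-coalgebra morphism from the operational model $(\mu\Sigma,\iota^\clubsuit)$. Then the kernel pair of $\mathrm{coit}\,\iota^\clubsuit$ is a congruence.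
   Context: Notation: $\mathrm{inl},\mathrm{inr}$ are coproduct injections, $\nabla\colon A+A\to A$ the codiagonal, $\langle f,g\rangle$ pairing into products. $\Sigma^\star$ denotes the free monad on $\Sigma$, $(\mu\Sigma,\iota)$ the initial $\Sigma$-algebra; for a $\Sigma$-algebra $(A,a)$, $(\!|a|\!)\colon\mu\Sigma\to A$ is the unique algebra morphism and $\hat a\colon\Sigma^\star A\to A$ is the unique $\Sigma$-algebra morphism from the free algebra $\Sigma^\star A$ extending $\mathrm{id}_A$. $V/\mathbb{C}$ is the coslice category (objects: pairs $(X,p_X\colon V\to X)$; morphisms $h$ with $h\circ p_X=p_Y$), and $j\colon V/\mathbb{C}\to\mathbb{C}$ is the forgetful functor. Every $\Sigma$-algebra $(A,a)$ is regarded as a $V$-pointed object via $V\xrightarrow{\mathrm{inl}} V+\Sigma'A=\Sigma A\xrightarrow{a}A$. A $V$-pointed higher-order GSOS law of $\Sigma$ over $B$ is a family of morphisms $\rho_{X,Y}\colon \Sigma(jX\times B(jX,Y))\to B(jX,\Sigma^\star(jX+Y))$ that is dinatural in $X\in V/\mathbb{C}$ and natural in $Y\in\mathbb{C}$. For every $\Sigma$-algebra $(A,a)$ there is a unique morphism $a^\clubsuit\colon\mu\Sigma\to B(A,A)$ with $a^\clubsuit\circ\iota = B(\mathrm{id},\hat a)\circ B(\mathrm{id},\Sigma^\star\nabla)\circ\rho_{A,A}\circ\Sigma\langle (\!|a|\!),a^\clubsuit\rangle$; the operational model is $\iota^\clubsuit\colon\mu\Sigma\to B(\mu\Sigma,\mu\Sigma)$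 (the case $(A,a)=(\mu\Sigma,\iota)$). The kernel pair $p_1,p_2\colon E\to\mu\Sigma$ of a morphism $f\colon\mu\Sigma\to Z$ is its pullback along itself; it is called a congruence if the coequalizer $q\colon\mu\Sigma\to Q$ of $p_1,p_2$ admits a $\Sigma$-algebra structure $a\colon\Sigma Q\to Q$ such that $q$ is a $\Sigma$-algebra morphism from $(\mu\Sigma,\iota)$ to $(Q,a)$. A regular category is one with finite limits, coequalizers of kernel pairs, and pullback-stable regular epimorphisms. -}

module Defs where

open import Level using (Level; _⊔_) renaming (suc to lsuc)
open import Relation.Binary using (Rel; IsEquivalence)
open import Data.Product using (Σ; _×_; _,_; Σ-syntax)

record Category (o ℓ e : Level) : Set (lsuc (o ⊔ ℓ ⊔ e)) where
  infix  4 _≈_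
  infixr 9 _∘_
  field
    Obj       : Set o
    Hom       : Obj → Obj → Set ℓ
    _≈_       : ∀ {A B} → Rel (Hom A B) e
    id        : ∀ {A} → Hom A A
    _∘_       : ∀ {A B C} → Hom B C → Hom A B → Hom A C
    equiv     : ∀ {A B} → IsEquivalence (_≈_ {A} {B})
    ∘-resp-≈  : ∀ {A B C} {f f' : Hom B C} {g g' : Hom A B} →
                f ≈ f' → g ≈ g' → f ∘ g ≈ f' ∘ g'
    assoc     : ∀ {A B C D} {f : Hom C D} {g : Hom B C} {h : Hom A B} →
                (f ∘ g) ∘ h ≈ f ∘ (g ∘ h)
    identityˡ : ∀ {A B} {f : Hom A B} → id ∘ f ≈ f
    identityʳ : ∀ {A B} {f : Hom A B} → f ∘ id ≈ f

record Functor {o ℓ e} (C : Category o ℓ e) : Set (o ⊔ ℓ ⊔ e) where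
  open Category C
  field
    F₀           : Obj → Obj
    F₁           : ∀ {A B} → Hom A B → Hom (F₀ A) (F₀ B)
    F-resp-≈     : ∀ {A B} {f g : Hom A B} → f ≈ g → F₁ f ≈ F₁ g
    identity     : ∀ {A} → F₁ (id {A}) ≈ id
    homomorphism : ∀ {A B C} {f : Hom A B} {g : Hom B C} →
                   F₁ (g ∘ f) ≈ F₁ g ∘ F₁ f

record Bifunctor {o ℓ e} (C : Category o ℓ e) : Set (o ⊔ ℓ ⊔ e) where
  open Category C
  field
    B₀           : Obj → Obj → Obj
    B₁           : ∀ {X X' Y Y'} → Hom X' X → Hom Y Y' → Hom (B₀ X Y) (B₀ X' Y')
    B-resp-≈     : ∀ {X X' Y Y'} {f f' : Hom X' X} {g g' : Hom Y Y'} →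
                   f ≈ f' → g ≈ g' → B₁ f g ≈ B₁ f' g'
    identity     : ∀ {X Y} → B₁ (id {X}) (id {Y}) ≈ id
    homomorphism : ∀ {X X' X'' Y Y' Y''}
                   {f : Hom X' X} {f' : Hom X'' X'} {g : Hom Y Y'} {g' : Hom Y' Y''} →
                   B₁ (f ∘ f') (g' ∘ g) ≈ B₁ f' g' ∘ B₁ f g

module Notions {o ℓ e} (C : Category o ℓ e) where
  open Category C

  Mono : ∀ {A B} → Hom A B → Set (o ⊔ ℓ ⊔ e)
  Mono {A} f = ∀ {W} (g h : Hom W A) → f ∘ g ≈ f ∘ h → g ≈ h

  Epi : ∀ {A B} → Hom A B → Set (o ⊔ ℓ ⊔ e)
  Epi {B = B} f = ∀ {W} (g h : Hom B W) → g ∘ f ≈ h ∘ f → g ≈ h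

  record IsPullback {A B Z P} (f : Hom A Z) (g : Hom B Z)
                    (p₁ : Hom P A) (p₂ : Hom P B) : Set (o ⊔ ℓ ⊔ e) where
    field
      commute  : f ∘ p₁ ≈ g ∘ p₂
      factor   : ∀ {W} (h₁ : Hom W A) (h₂ : Hom W B) → f ∘ h₁ ≈ g ∘ h₂ → Hom W P
      factor-p₁ : ∀ {W} {h₁ : Hom W A} {h₂ : Hom W B} (eq : f ∘ h₁ ≈ g ∘ h₂) →
                  p₁ ∘ factor h₁ h₂ eq ≈ h₁
      factor-p₂ : ∀ {W} {h₁ : Hom W A} {h₂ : Hom W B} (eq : f ∘ h₁ ≈ g ∘ h₂) →
                  p₂ ∘ factor h₁ h₂ eq ≈ h₂
      unique   : ∀ {W} {h₁ : Hom W A} {h₂ : Hom W B} (eq : f ∘ h₁ ≈ g ∘ h₂)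
                 (u : Hom W P) → p₁ ∘ u ≈ h₁ → p₂ ∘ u ≈ h₂ → u ≈ factor h₁ h₂ eq

  record IsCoequalizer {A B Q} (f g : Hom A B) (q : Hom B Q) : Set (o ⊔ ℓ ⊔ e) where
    field
      commute  : q ∘ f ≈ q ∘ g
      factor   : ∀ {W} (h : Hom B W) → h ∘ f ≈ h ∘ g → Hom Q W
      factor-q : ∀ {W} {h : Hom B W} (eq : h ∘ f ≈ h ∘ g) → factor h eq ∘ q ≈ h
      unique   : ∀ {W} {h : Hom B W} (eq : h ∘ f ≈ h ∘ g) (u : Hom Q W) →
                 u ∘ q ≈ h → u ≈ factor h eq

  RegularEpi : ∀ {A B} → Hom A B → Set (o ⊔ ℓ ⊔ e)
  RegularEpi {A} q = Σ[ K ∈ Obj ] Σ[ f ∈ Hom K A ] Σ[ g ∈ Hom K A ] IsCoequalizer f g q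

  record Terminal : Set (o ⊔ ℓ ⊔ e) where
    field
      ⊤        : Obj
      !        : ∀ {A} → Hom A ⊤
      !-unique : ∀ {A} (h : Hom A ⊤) → h ≈ !

  record Initial : Set (o ⊔ ℓ ⊔ e) where
    field
      ⊥        : Obj
      ¡        : ∀ {A} → Hom ⊥ A
      ¡-unique : ∀ {A} (h : Hom ⊥ A) → h ≈ ¡

  record Product (A B : Obj) : Set (o ⊔ ℓ ⊔ e) where
    field
      obj     : Obj
      π₁      : Hom obj A
      π₂      : Hom obj B
      ⟨_,_⟩   : ∀ {W} → Hom W A → Hom W B → Hom W obj
      project₁ : ∀ {W} {f : Hom W A} {g : Hom W B} → π₁ ∘ ⟨ f , g ⟩ ≈ f
      project₂ : ∀ {W} {f : Hom W A} {g : Hom W B} → π₂ ∘ ⟨ f , g ⟩ ≈ g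
      unique  : ∀ {W} {f : Hom W A} {g : Hom W B} (h : Hom W obj) →
                π₁ ∘ h ≈ f → π₂ ∘ h ≈ g → h ≈ ⟨ f , g ⟩

  record Coproduct (A B : Obj) : Set (o ⊔ ℓ ⊔ e) where
    field
      obj    : Obj
      inl    : Hom A obj
      inr    : Hom B obj
      [_,_]  : ∀ {W} → Hom A W → Hom B W → Hom obj W
      inject₁ : ∀ {W} {f : Hom A W} {g : Hom B W} → [ f , g ] ∘ inl ≈ f
      inject₂ : ∀ {W} {f : Hom A W} {g : Hom B W} → [ f , g ] ∘ inr ≈ g
      unique : ∀ {W} {f : Hom A W} {g : Hom B W} (h : Hom obj W) →
               h ∘ inl ≈ f → h ∘ inr ≈ g → h ≈ [ f , g ]

  record Pullback {A B Z} (f : Hom A Z) (g : Hom B Z) : Set (o ⊔ ℓ ⊔ e) where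
    field
      P          : Obj
      p₁         : Hom P A
      p₂         : Hom P B
      isPullback : IsPullback f g p₁ p₂

  record Coequalizer {A B} (f g : Hom A B) : Set (o ⊔ ℓ ⊔ e) where
    field
      Q             : Obj
      q             : Hom B Q
      isCoequalizer : IsCoequalizer f g q

  record FiniteLimits : Set (o ⊔ ℓ ⊔ e) where
    field
      terminal : Terminal
      product  : ∀ A B → Product A B
      pullback : ∀ {A B Z} (f : Hom A Z) (g : Hom B Z) → Pullback f g

  record FiniteColimits : Set (o ⊔ ℓ ⊔ e) where
    field
      initial     : Initial
      coproduct   : ∀ A B → Coproduct A B
      coequalizer : ∀ {A B} (f g : Hom A B) → Coequalizer f g

  record IsRegular : Set (o ⊔ ℓ ⊔ e) where
    field
      kernelPair-coeq : ∀ {A B E} (f : Hom A B) (p₁ p₂ : Hom E A) →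
                        IsPullback f f p₁ p₂ →
                        Σ[ Q ∈ Obj ] Σ[ q ∈ Hom A Q ] IsCoequalizer p₁ p₂ q
      pullback-stable : ∀ {A B Z P} {r : Hom A Z} {g : Hom B Z}
                        {p₁ : Hom P A} {p₂ : Hom P B} →
                        IsPullback r g p₁ p₂ → RegularEpi r → RegularEpi p₂

  record FreeAlgebras (F₀ : Obj → Obj)
                      (F₁ : ∀ {A B} → Hom A B → Hom (F₀ A) (F₀ B)) : Set (o ⊔ ℓ ⊔ e) where
    field
      Free       : Obj → Obj
      alg        : ∀ X → Hom (F₀ (Free X)) (Free X)
      η          : ∀ X → Hom X (Free X)
      ext        : ∀ {X A} (a : Hom (F₀ A) A) (h : Hom X A) → Hom (Free X) A
      ext-hom    : ∀ {X A} {a : Hom (F₀ A) A} {h : Hom X A} →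
                   ext a h ∘ alg X ≈ a ∘ F₁ (ext a h)
      ext-η      : ∀ {X A} {a : Hom (F₀ A) A} {h : Hom X A} → ext a h ∘ η X ≈ h
      ext-unique : ∀ {X A} {a : Hom (F₀ A) A} {h : Hom X A} (g : Hom (Free X) A) →
                   g ∘ alg X ≈ a ∘ F₁ g → g ∘ η X ≈ h → g ≈ ext a h

module Setting {o ℓ e} (C : Category o ℓ e)
               (lim : Notions.FiniteLimits C) (colim : Notions.FiniteColimits C)
               (V : Category.Obj C) (Sig' : Functor C)
               (free' : Notions.FreeAlgebras C (Functor.F₀ Sig') (Functor.F₁ Sig'))
               (B : Bifunctor C) where
  open Category C
  open Notions C
  open Bifunctor B
  open Functor Sig' renaming (F₀ to Sig'₀; F₁ to Sig'₁)
  open FiniteLimits lim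
  open FiniteColimits colim
  module FA' = FreeAlgebras free'

  _⊕_ : Obj → Obj → Obj
  A ⊕ B' = Coproduct.obj (coproduct A B')

  inl : ∀ {A B'} → Hom A (A ⊕ B')
  inl {A} {B'} = Coproduct.inl (coproduct A B')

  inr : ∀ {A B'} → Hom B' (A ⊕ B')
  inr {A} {B'} = Coproduct.inr (coproduct A B')

  [_,_] : ∀ {A B' W} → Hom A W → Hom B' W → Hom (A ⊕ B') W
  [_,_] {A} {B'} f g = Coproduct.[_,_] (coproduct A B') f g

  _+₁_ : ∀ {A A' B' B''} → Hom A A' → Hom B' B'' → Hom (A ⊕ B') (A' ⊕ B'')
  f +₁ g = [ inl ∘ f , inr ∘ g ]

  ∇ : ∀ {A} → Hom (A ⊕ A) A
  ∇ = [ id , id ]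

  _⊗_ : Obj → Obj → Obj
  A ⊗ B' = Product.obj (product A B')

  π₁ : ∀ {A B'} → Hom (A ⊗ B') A
  π₁ {A} {B'} = Product.π₁ (product A B')

  π₂ : ∀ {A B'} → Hom (A ⊗ B') B'
  π₂ {A} {B'} = Product.π₂ (product A B')

  ⟨_,_⟩ : ∀ {W A B'} → Hom W A → Hom W B' → Hom W (A ⊗ B')
  ⟨_,_⟩ {W} {A} {B'} f g = Product.⟨_,_⟩ (product A B') f g

  _×₁_ : ∀ {A A' B' B''} → Hom A A' → Hom B' B'' → Hom (A ⊗ B') (A' ⊗ B'')
  f ×₁ g = ⟨ f ∘ π₁ , g ∘ π₂ ⟩

  𝟘 : Obj
  𝟘 = Initial.⊥ initial

  ¡ : ∀ {A} → Hom 𝟘 A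
  ¡ = Initial.¡ initial

  Sig₀ : Obj → Obj
  Sig₀ X = V ⊕ Sig'₀ X

  Sig₁ : ∀ {X Y} → Hom X Y → Hom (Sig₀ X) (Sig₀ Y)
  Sig₁ f = id +₁ Sig'₁ f

  -- Free Σ-algebras, obtained from the free Σ'-algebras:
  -- Σ⋆X = Σ'-free algebra on V + X, with Σ-structure [η ∘ inl , alg].
  Sig⋆ : Obj → Obj
  Sig⋆ X = FA'.Free (V ⊕ X)

  algSig : ∀ X → Hom (Sig₀ (Sig⋆ X)) (Sig⋆ X)
  algSig X = [ FA'.η (V ⊕ X) ∘ inl , FA'.alg (V ⊕ X) ]

  ηSig : ∀ X → Hom X (Sig⋆ X)
  ηSig X = FA'.η (V ⊕ X) ∘ inr

  extSig : ∀ {X A} (a : Hom (Sig₀ A) A) (h : Hom X A) → Hom (Sig⋆ X) A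
  extSig a h = FA'.ext (a ∘ inr) [ a ∘ inl , h ]

  Sig⋆₁ : ∀ {X Y} → Hom X Y → Hom (Sig⋆ X) (Sig⋆ Y)
  Sig⋆₁ {X} {Y} f = extSig (algSig Y) (ηSig Y ∘ f)

  hat : ∀ {A} → Hom (Sig₀ A) A → Hom (Sig⋆ A) A
  hat a = extSig a id

  μSig : Obj
  μSig = Sig⋆ 𝟘

  ι : Hom (Sig₀ μSig) μSig
  ι = algSig 𝟘

  fold : ∀ {A} → Hom (Sig₀ A) A → Hom μSig A
  fold a = extSig a ¡

  -- V-pointed higher-order GSOS law of Σ over B; an object of V/C is a pair
  -- (X , p : V → X), a morphism h : (X , p) → (X' , p') satisfies h ∘ p ≈ p'.
  record GSOSLaw : Set (o ⊔ ℓ ⊔ e) where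
    field
      ρ         : (X : Obj) (p : Hom V X) (Y : Obj) →
                  Hom (Sig₀ (X ⊗ B₀ X Y)) (B₀ X (Sig⋆ (X ⊕ Y)))
      dinatural : ∀ {X X' Y} {p : Hom V X} {p' : Hom V X'} (h : Hom X X') →
                  h ∘ p ≈ p' →
                  B₁ id (Sig⋆₁ (h +₁ id)) ∘ ρ X p Y ∘ Sig₁ (id ×₁ B₁ h id)
                    ≈ B₁ h id ∘ ρ X' p' Y ∘ Sig₁ (h ×₁ id)
      natural   : ∀ {X Y Y'} {p : Hom V X} (g : Hom Y Y') →
                  B₁ id (Sig⋆₁ (id +₁ g)) ∘ ρ X p Y ≈ ρ X p Y' ∘ Sig₁ (id ×₁ B₁ id g)

  IsClub : GSOSLaw → ∀ {A} (a : Hom (Sig₀ A) A) → Hom μSig (B₀ A A) → Set e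
  IsClub law {A} a c =
    c ∘ ι ≈ B₁ id (hat a) ∘ B₁ id (Sig⋆₁ ∇) ∘ GSOSLaw.ρ law A (a ∘ inl) A ∘ Sig₁ ⟨ fold a , c ⟩

  IsOperationalModel : GSOSLaw → Hom μSig (B₀ μSig μSig) → Set e
  IsOperationalModel law c = IsClub law ι c

  record FinalCoalgebra : Set (o ⊔ ℓ ⊔ e) where
    field
      Z           : Obj
      ζ           : Hom Z (B₀ μSig Z)
      coit        : ∀ {A} → Hom A (B₀ μSig A) → Hom A Z
      coit-hom    : ∀ {A} {α : Hom A (B₀ μSig A)} → ζ ∘ coit α ≈ B₁ id (coit α) ∘ α
      coit-unique : ∀ {A} {α : Hom A (B₀ μSig A)} (g : Hom A Z) →
                    ζ ∘ g ≈ B₁ id g ∘ α → g ≈ coit α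

  SigPreservesReflexiveCoequalizers : Set (o ⊔ ℓ ⊔ e)
  SigPreservesReflexiveCoequalizers =
    ∀ {A B' Q} (f g : Hom A B') (s : Hom B' A) → f ∘ s ≈ id → g ∘ s ≈ id →
    (q : Hom B' Q) → IsCoequalizer f g q → IsCoequalizer (Sig₁ f) (Sig₁ g) (Sig₁ q)

  BPreservesMonos : Set (o ⊔ ℓ ⊔ e)
  BPreservesMonos =
    ∀ {X X' Y Y'} (f : Hom X' X) (g : Hom Y Y') → Epi f → Mono g → Mono (B₁ f g)

  IsCongruence : ∀ {E} → Hom E μSig → Hom E μSig → Set (o ⊔ ℓ ⊔ e)
  IsCongruence p₁ p₂ =
    ∀ {Q} (q : Hom μSig Q) → IsCoequalizer p₁ p₂ q →
    Σ[ a ∈ Hom (Sig₀ Q) Q ] q ∘ ι ≈ a ∘ Sig₁ q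

  KernelPairIsCongruence : ∀ {Z} → Hom μSig Z → Set (o ⊔ ℓ ⊔ e)
  KernelPairIsCongruence f =
    ∀ {E} (p₁ p₂ : Hom E μSig) → IsPullback f f p₁ p₂ → IsCongruence p₁ p₂

{-# OPTIONS --safe #-}

-- Let p₁, p₂ be the kernel pair of f = coit c, with extensions p̂₁, p̂₂ to the free algebra Σ⋆E, and
-- let q be the coequalizer of p̂₁, p̂₂, which is an algebra (Q , a) because p̂₁, p̂₂ is reflexive.
-- The club of a is the second component of an algebra morphism μΣ → Q × B(Q , Q).  This morphism
-- merges p₁, p₂ (f has a monic image, and B preserves the monos in question), hence also p̂₁, p̂₂.
-- By dinaturality B(id , q) ∘ c = B(q , id) ∘ a♣, so Q is a B(μΣ , -)-coalgebra quotient of μΣ and f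
-- factors through q.  Therefore f merges p̂₁, p̂₂, which says that E is closed under ι.
module Submission where

open import Defs
open import Data.Product using (Σ-syntax; _,_; proj₁; proj₂)
open import Relation.Binary using (Setoid; IsEquivalence)
import Relation.Binary.Reasoning.Setoid as SetoidReasoning

-- Epimorphisms, kernel pairs and images in a regular category.

module CategoryLemmas {o ℓ e} (C : Category o ℓ e) where
  open Category C
  open Notions C

  hom-setoid : Obj → Obj → Setoid ℓ e
  hom-setoid A B = record { Carrier = Hom A B ; _≈_ = _≈_ ; isEquivalence = equiv }

  ≈-refl : ∀ {A B} {f : Hom A B} → f ≈ f
  ≈-refl = IsEquivalence.refl equiv

  ≈-sym : ∀ {A B} {f g : Hom A B} → f ≈ g → g ≈ f
  ≈-sym = IsEquivalence.sym equiv

  ≈-trans : ∀ {A B} {f g h : Hom A B} → f ≈ g → g ≈ h → f ≈ h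
  ≈-trans = IsEquivalence.trans equiv

  module ≈-Reasoning {A B} = SetoidReasoning (hom-setoid A B)

  ∘-congˡ : ∀ {A B D} {f : Hom B D} {g h : Hom A B} → g ≈ h → f ∘ g ≈ f ∘ h
  ∘-congˡ = ∘-resp-≈ ≈-refl

  ∘-congʳ : ∀ {A B D} {f g : Hom B D} {h : Hom A B} → f ≈ g → f ∘ h ≈ g ∘ h
  ∘-congʳ eq = ∘-resp-≈ eq ≈-refl

  pullˡ : ∀ {A B D D'} {f : Hom D D'} {g : Hom B D} {h : Hom B D'} {k : Hom A B} →
          f ∘ g ≈ h → f ∘ g ∘ k ≈ h ∘ k
  pullˡ eq = ≈-trans (≈-sym assoc) (∘-congʳ eq)

  pullʳ : ∀ {A B D D'} {f : Hom D D'} {g : Hom B D} {k : Hom A B} {h : Hom A D} →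
          g ∘ k ≈ h → (f ∘ g) ∘ k ≈ f ∘ h
  pullʳ eq = ≈-trans assoc (∘-congˡ eq)

  coequalizer-epi : ∀ {A B Q} {f g : Hom A B} {q : Hom B Q} → IsCoequalizer f g q → Epi q
  coequalizer-epi {f = f} {g} {q} coeq u v eq =
    ≈-trans (unique v∘q-merges u eq) (≈-sym (unique v∘q-merges v ≈-refl))
    where
    open IsCoequalizer coeq
    v∘q-merges : (v ∘ q) ∘ f ≈ (v ∘ q) ∘ g
    v∘q-merges = ≈-trans (pullʳ commute) (≈-sym assoc)

  regularEpi⇒epi : ∀ {A B} {q : Hom A B} → RegularEpi q → Epi q
  regularEpi⇒epi (_ , _ , _ , coeq) = coequalizer-epi coeq

  module Diagonal {A Z E} {f : Hom A Z} {p₁ p₂ : Hom E A} (kp : IsPullback f f p₁ p₂) where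
    open IsPullback kp

    diagonal : Hom A E
    diagonal = factor id id ≈-refl

    p₁∘diagonal : p₁ ∘ diagonal ≈ id
    p₁∘diagonal = factor-p₁ ≈-refl

    p₂∘diagonal : p₂ ∘ diagonal ≈ id
    p₂∘diagonal = factor-p₂ ≈-refl

  -- Generalised elements g, h of Q lift to A after pulling q back along them.
  image-mono : FiniteLimits → IsRegular →
               ∀ {A Z E Q} {f : Hom A Z} {p₁ p₂ : Hom E A} {q : Hom A Q} {m : Hom Q Z} →
               IsPullback f f p₁ p₂ → IsCoequalizer p₁ p₂ q → m ∘ q ≈ f → Mono m
  image-mono lim reg {f = f} {p₁} {p₂} {q} {m} kp coeq mq≈f g h mg≈mh =
    regularEpi⇒epi e₁-regular g h
      (regularEpi⇒epi e₂-regular (g ∘ e₁) (h ∘ e₁) (begin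
        (g ∘ e₁) ∘ e₂     ≈⟨ ∘-congʳ qg'≈ge₁ ⟨
        (q ∘ g') ∘ e₂     ≈⟨ pullʳ (≈-sym (factor-p₁ g'e₂~h')) ⟩
        q ∘ p₁ ∘ u        ≈⟨ pullˡ (IsCoequalizer.commute coeq) ⟩
        (q ∘ p₂) ∘ u      ≈⟨ pullʳ (factor-p₂ g'e₂~h') ⟩
        q ∘ h'            ≈⟨ qh'≈he₁e₂ ⟩
        (h ∘ e₁) ∘ e₂     ∎))
    where
    open ≈-Reasoning
    open IsPullback kp using (factor; factor-p₁; factor-p₂)
    module P₁ = Pullback (FiniteLimits.pullback lim q g)
    open P₁ using () renaming (p₁ to g'; p₂ to e₁)
    -- Pulling back along `h ∘ e₁` instead of `h` puts the lifts `g' ∘ e₂` and `h'` on one common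
    -- domain.
    module P₂ = Pullback (FiniteLimits.pullback lim q (h ∘ e₁))
    open P₂ using () renaming (p₁ to h'; p₂ to e₂)

    e₁-regular : RegularEpi e₁
    e₁-regular = IsRegular.pullback-stable reg P₁.isPullback (_ , _ , _ , coeq)

    e₂-regular : RegularEpi e₂
    e₂-regular = IsRegular.pullback-stable reg P₂.isPullback (_ , _ , _ , coeq)

    qg'≈ge₁ : q ∘ g' ≈ g ∘ e₁
    qg'≈ge₁ = IsPullback.commute P₁.isPullback

    qh'≈he₁e₂ : q ∘ h' ≈ (h ∘ e₁) ∘ e₂
    qh'≈he₁e₂ = IsPullback.commute P₂.isPullback

    g'e₂~h' : f ∘ (g' ∘ e₂) ≈ f ∘ h'
    g'e₂~h' = begin
      f ∘ g' ∘ e₂         ≈⟨ ∘-congʳ mq≈f ⟨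
      (m ∘ q) ∘ g' ∘ e₂   ≈⟨ pullʳ (pullˡ qg'≈ge₁) ⟩
      m ∘ (g ∘ e₁) ∘ e₂   ≈⟨ ∘-congˡ assoc ⟩
      m ∘ g ∘ e₁ ∘ e₂     ≈⟨ pullˡ mg≈mh ⟩
      (m ∘ h) ∘ e₁ ∘ e₂   ≈⟨ pullʳ (≈-sym assoc) ⟩
      m ∘ (h ∘ e₁) ∘ e₂   ≈⟨ ∘-congˡ qh'≈he₁e₂ ⟨
      m ∘ q ∘ h'          ≈⟨ pullˡ mq≈f ⟩
      f ∘ h'              ∎

    -- Since `f` identifies the two lifts, they form a generalised element of the kernel pair, and
    -- `q` merges its two components.
    u : Hom P₂.P _
    u = factor (g' ∘ e₂) h' g'e₂~h'

module SettingLemmas {o ℓ e} (C : Category o ℓ e)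
                     (lim : Notions.FiniteLimits C) (colim : Notions.FiniteColimits C)
                     (V : Category.Obj C) (Sig' : Functor C)
                     (free' : Notions.FreeAlgebras C (Functor.F₀ Sig') (Functor.F₁ Sig'))
                     (B : Bifunctor C) where
  open Category C
  open Notions C
  open CategoryLemmas C
  open ≈-Reasoning
  open Setting C lim colim V Sig' free' B
  open Bifunctor B using (B₀; B₁; B-resp-≈)
  open Functor Sig' using () renaming (F₁ to Sig'₁)

  private
    module Prod {X Y} = Product (FiniteLimits.product lim X Y)
    module Coprod {X Y} = Coproduct (FiniteColimits.coproduct colim X Y)

  -- Calculus of binary products and coproducts.

  ⟨⟩-cong : ∀ {W X Y} {f f' : Hom W X} {g g' : Hom W Y} → f ≈ f' → g ≈ g' → ⟨ f , g ⟩ ≈ ⟨ f' , g' ⟩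
  ⟨⟩-cong eq₁ eq₂ = Prod.unique _ (≈-trans Prod.project₁ eq₁) (≈-trans Prod.project₂ eq₂)

  ⟨⟩-∘ : ∀ {W W' X Y} {f : Hom W X} {g : Hom W Y} {k : Hom W' W} → ⟨ f , g ⟩ ∘ k ≈ ⟨ f ∘ k , g ∘ k ⟩
  ⟨⟩-∘ = Prod.unique _ (pullˡ Prod.project₁) (pullˡ Prod.project₂)

  π-η : ∀ {W X Y} {k : Hom W (X ⊗ Y)} → k ≈ ⟨ π₁ ∘ k , π₂ ∘ k ⟩
  π-η = Prod.unique _ ≈-refl ≈-refl

  ×₁-⟨⟩ : ∀ {W X X' Y Y'} {h : Hom X X'} {k : Hom Y Y'} {f : Hom W X} {g : Hom W Y} →
          (h ×₁ k) ∘ ⟨ f , g ⟩ ≈ ⟨ h ∘ f , k ∘ g ⟩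
  ×₁-⟨⟩ = ≈-trans ⟨⟩-∘ (⟨⟩-cong (pullʳ Prod.project₁) (pullʳ Prod.project₂))

  []-cong : ∀ {X Y W} {f f' : Hom X W} {g g' : Hom Y W} → f ≈ f' → g ≈ g' → [ f , g ] ≈ [ f' , g' ]
  []-cong eq₁ eq₂ = Coprod.unique _ (≈-trans Coprod.inject₁ eq₁) (≈-trans Coprod.inject₂ eq₂)

  ∘-[] : ∀ {X Y W W'} {f : Hom X W} {g : Hom Y W} {k : Hom W W'} → k ∘ [ f , g ] ≈ [ k ∘ f , k ∘ g ]
  ∘-[] = Coprod.unique _ (pullʳ Coprod.inject₁) (pullʳ Coprod.inject₂)

  []-+₁ : ∀ {X X' Y Y' W} {f : Hom X' W} {g : Hom Y' W} {h : Hom X X'} {k : Hom Y Y'} →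
          [ f , g ] ∘ (h +₁ k) ≈ [ f ∘ h , g ∘ k ]
  []-+₁ = ≈-trans ∘-[] ([]-cong (pullˡ Coprod.inject₁) (pullˡ Coprod.inject₂))

  -- The signature functor and its algebra morphisms.

  Sig₁-cong : ∀ {X Y} {f g : Hom X Y} → f ≈ g → Sig₁ f ≈ Sig₁ g
  Sig₁-cong eq = []-cong ≈-refl (∘-congˡ (Functor.F-resp-≈ Sig' eq))

  Sig₁-∘ : ∀ {X Y W} {f : Hom X Y} {g : Hom Y W} → Sig₁ g ∘ Sig₁ f ≈ Sig₁ (g ∘ f)
  Sig₁-∘ = ≈-trans []-+₁
    ([]-cong identityʳ (pullʳ (≈-sym (Functor.homomorphism Sig'))))

  Sig₁-inl : ∀ {X Y} {f : Hom X Y} → Sig₁ f ∘ inl ≈ inl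
  Sig₁-inl = ≈-trans Coprod.inject₁ identityʳ

  IsHom : ∀ {X Y} → Hom (Sig₀ X) X → Hom (Sig₀ Y) Y → Hom X Y → Set e
  IsHom a b h = h ∘ a ≈ b ∘ Sig₁ h

  hom-∘ : ∀ {X Y W} {a : Hom (Sig₀ X) X} {b : Hom (Sig₀ Y) Y} {d : Hom (Sig₀ W) W}
            {h : Hom X Y} {k : Hom Y W} → IsHom b d k → IsHom a b h → IsHom a d (k ∘ h)
  hom-∘ {a = a} {b} {d} {h} {k} hom-k hom-h = begin
    (k ∘ h) ∘ a         ≈⟨ pullʳ hom-h ⟩
    k ∘ b ∘ Sig₁ h      ≈⟨ pullˡ hom-k ⟩
    (d ∘ Sig₁ k) ∘ Sig₁ h ≈⟨ pullʳ Sig₁-∘ ⟩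
    d ∘ Sig₁ (k ∘ h)    ∎

  -- Makes an algebra morphism a morphism of the coslice under `V`, the only kind to which
  -- dinaturality of the law applies.
  hom-inl : ∀ {X Y} {a : Hom (Sig₀ X) X} {b : Hom (Sig₀ Y) Y} {h : Hom X Y} →
            IsHom a b h → h ∘ (a ∘ inl) ≈ b ∘ inl
  hom-inl hom-h = ≈-trans (pullˡ hom-h) (pullʳ Sig₁-inl)

  -- Universal property of the free algebras and fusion laws.

  module _ {X A : Obj} {a : Hom (Sig₀ A) A} where

    extSig-hom : ∀ {h : Hom X A} → IsHom (algSig X) a (extSig a h)
    extSig-hom {h} = begin
      extSig a h ∘ algSig X
        ≈⟨ ∘-[] ⟩
      [ extSig a h ∘ FA'.η (V ⊕ X) ∘ inl , extSig a h ∘ FA'.alg (V ⊕ X) ]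
        ≈⟨ []-cong (≈-trans (pullˡ FA'.ext-η) Coprod.inject₁) FA'.ext-hom ⟩
      [ a ∘ inl , (a ∘ inr) ∘ Sig'₁ (extSig a h) ]
        ≈⟨ []-cong (∘-congˡ identityʳ) (≈-sym assoc) ⟨
      [ a ∘ inl ∘ id , a ∘ inr ∘ Sig'₁ (extSig a h) ]
        ≈⟨ ∘-[] ⟨
      a ∘ Sig₁ (extSig a h) ∎

    extSig-η : ∀ {h : Hom X A} → extSig a h ∘ ηSig X ≈ h
    extSig-η = ≈-trans (pullˡ FA'.ext-η) Coprod.inject₂

    -- The constants in `V` are generators of the underlying free Σ'-algebra. Accordingly the
    -- morphism condition splits: its `inr` half is the condition for Σ'-morphisms, and its `inl`
    -- half fixes the values on `V`.
    extSig-unique : ∀ {h : Hom X A} {g : Hom (Sig⋆ X) A} →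
                    IsHom (algSig X) a g → g ∘ ηSig X ≈ h → g ≈ extSig a h
    extSig-unique {h} {g} hom-g g∘η≈h = FA'.ext-unique g g∘alg
      (Coprod.unique _ g∘η∘inl (≈-trans assoc g∘η≈h))
      where
      g∘alg : g ∘ FA'.alg (V ⊕ X) ≈ (a ∘ inr) ∘ Sig'₁ g
      g∘alg = begin
        g ∘ FA'.alg (V ⊕ X)   ≈⟨ ∘-congˡ Coprod.inject₂ ⟨
        g ∘ algSig X ∘ inr    ≈⟨ pullˡ hom-g ⟩
        (a ∘ Sig₁ g) ∘ inr    ≈⟨ pullʳ Coprod.inject₂ ⟩
        a ∘ inr ∘ Sig'₁ g     ≈⟨ assoc ⟨
        (a ∘ inr) ∘ Sig'₁ g   ∎

      g∘η∘inl : (g ∘ FA'.η (V ⊕ X)) ∘ inl ≈ a ∘ inl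
      g∘η∘inl = ≈-trans (pullʳ (≈-sym Coprod.inject₁)) (hom-inl hom-g)

  extSig-cong : ∀ {X A} {a : Hom (Sig₀ A) A} {h k : Hom X A} → h ≈ k → extSig a h ≈ extSig a k
  extSig-cong eq = extSig-unique extSig-hom (≈-trans extSig-η eq)

  hom-∘-extSig : ∀ {X A A'} {a : Hom (Sig₀ A) A} {a' : Hom (Sig₀ A') A'} {h : Hom A A'} {k : Hom X A} →
                 IsHom a a' h → h ∘ extSig a k ≈ extSig a' (h ∘ k)
  hom-∘-extSig hom-h = extSig-unique (hom-∘ hom-h extSig-hom) (pullʳ extSig-η)

  extSig-∘-Sig⋆₁ : ∀ {X Y A} {a : Hom (Sig₀ A) A} {k : Hom Y A} {f : Hom X Y} →
                   extSig a k ∘ Sig⋆₁ f ≈ extSig a (k ∘ f)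
  extSig-∘-Sig⋆₁ = ≈-trans (hom-∘-extSig extSig-hom) (extSig-cong (pullˡ extSig-η))

  fold-unique : ∀ {A} {a : Hom (Sig₀ A) A} {g : Hom μSig A} → IsHom ι a g → g ≈ fold a
  fold-unique hom-g =
    extSig-unique hom-g (Initial.¡-unique (FiniteColimits.initial colim) _)

  fold-hom : ∀ {A} {a : Hom (Sig₀ A) A} → IsHom ι a (fold a)
  fold-hom = extSig-hom

  -- Primitive recursion on `μSig`, encoded as iteration into a product.

  pairAlg : ∀ {A D} → Hom (Sig₀ A) A → Hom (Sig₀ (A ⊗ D)) D → Hom (Sig₀ (A ⊗ D)) (A ⊗ D)
  pairAlg a t = ⟨ a ∘ Sig₁ π₁ , t ⟩

  module _ {A D : Obj} {a : Hom (Sig₀ A) A} {t : Hom (Sig₀ (A ⊗ D)) D} where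

    π₁-hom : IsHom (pairAlg a t) a π₁
    π₁-hom = Prod.project₁

    pair-hom : ∀ {X} {x : Hom (Sig₀ X) X} {u : Hom X A} {v : Hom X D} →
               IsHom x a u → v ∘ x ≈ t ∘ Sig₁ ⟨ u , v ⟩ → IsHom x (pairAlg a t) ⟨ u , v ⟩
    pair-hom {x = x} {u} {v} hom-u rec-v = begin
      ⟨ u , v ⟩ ∘ x
        ≈⟨ ⟨⟩-∘ ⟩
      ⟨ u ∘ x , v ∘ x ⟩
        ≈⟨ ⟨⟩-cong (≈-trans hom-u (≈-sym (pullʳ (≈-trans Sig₁-∘ (Sig₁-cong Prod.project₁))))) rec-v ⟩
      ⟨ (a ∘ Sig₁ π₁) ∘ Sig₁ ⟨ u , v ⟩ , t ∘ Sig₁ ⟨ u , v ⟩ ⟩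
        ≈⟨ ⟨⟩-∘ ⟨
      pairAlg a t ∘ Sig₁ ⟨ u , v ⟩ ∎

    para : Hom μSig D
    para = π₂ ∘ fold (pairAlg a t)

    ⟨fold,para⟩ : fold (pairAlg a t) ≈ ⟨ fold a , para ⟩
    ⟨fold,para⟩ = ≈-trans π-η (⟨⟩-cong (fold-unique (hom-∘ π₁-hom fold-hom)) ≈-refl)

    para-rec : para ∘ ι ≈ t ∘ Sig₁ ⟨ fold a , para ⟩
    para-rec = begin
      (π₂ ∘ fold (pairAlg a t)) ∘ ι                    ≈⟨ pullʳ fold-hom ⟩
      π₂ ∘ pairAlg a t ∘ Sig₁ (fold (pairAlg a t))     ≈⟨ pullˡ Prod.project₂ ⟩
      t ∘ Sig₁ (fold (pairAlg a t))                    ≈⟨ ∘-congˡ (Sig₁-cong ⟨fold,para⟩) ⟩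
      t ∘ Sig₁ ⟨ fold a , para ⟩                       ∎

    -- Paired with `fold a`, any solution becomes an algebra morphism into the pair algebra, and
    -- initiality of `μSig` allows only one.
    para-unique : ∀ {v : Hom μSig D} → v ∘ ι ≈ t ∘ Sig₁ ⟨ fold a , v ⟩ → v ≈ para
    para-unique {v} rec-v = begin
      v                          ≈⟨ Prod.project₂ ⟨
      π₂ ∘ ⟨ fold a , v ⟩        ≈⟨ ∘-congˡ (fold-unique (pair-hom fold-hom rec-v)) ⟩
      para                       ∎

  B-merge : ∀ {X X' X'' Y Y' Y''} {f : Hom X' X} {f' : Hom X'' X'} {g : Hom Y Y'} {g' : Hom Y' Y''}
              {h : Hom X'' X} {k : Hom Y Y''} →
            f ∘ f' ≈ h → g' ∘ g ≈ k → B₁ f' g' ∘ B₁ f g ≈ B₁ h k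
  B-merge eq₁ eq₂ = ≈-trans (≈-sym (Bifunctor.homomorphism B)) (B-resp-≈ eq₁ eq₂)

  -- Clubs: existence, dinaturality, and compatibility with free extensions.

  module ClubLemmas (law : GSOSLaw) where
    open GSOSLaw law

    -- The operation on the right of the club equation, with the evaluation and the codiagonal fused
    -- into one extension and generalised along `h`. At `h = id` the copairing is `∇` and the club
    -- equation itself is recovered; general `h` serves to compare the clubs of two algebras.
    clubStep : ∀ {A A'} → Hom (Sig₀ A) A → Hom (Sig₀ A') A' → Hom A A' →
               Hom (Sig₀ (A ⊗ B₀ A A')) (B₀ A A')
    clubStep {A} {A'} a a' h = B₁ id (extSig a' [ h , id ]) ∘ ρ A (a ∘ inl) A'

    club-step : ∀ {A} {a : Hom (Sig₀ A) A} {W} {v : Hom W (Sig₀ (A ⊗ B₀ A A))} →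
                clubStep a a id ∘ v
                  ≈ B₁ id (hat a) ∘ B₁ id (Sig⋆₁ ∇) ∘ ρ A (a ∘ inl) A ∘ v
    club-step {A} {a} {_} {v} = ≈-sym (begin
      B₁ id (hat a) ∘ B₁ id (Sig⋆₁ ∇) ∘ ρ A (a ∘ inl) A ∘ v
        ≈⟨ pullˡ (B-merge identityˡ (≈-trans extSig-∘-Sig⋆₁ (extSig-cong identityˡ))) ⟩
      B₁ id (extSig a ∇) ∘ ρ A (a ∘ inl) A ∘ v
        ≈⟨ assoc ⟨
      clubStep a a id ∘ v ∎)

    club : ∀ {A} → Hom (Sig₀ A) A → Hom μSig (B₀ A A)
    club a = para {a = a} {t = clubStep a a id}

    club-isClub : ∀ {A} (a : Hom (Sig₀ A) A) → IsClub law a (club a)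
    club-isClub a = ≈-trans para-rec club-step

    -- Both composites solve the same primitive recursion, with parameter clubStep a a' h.
    club-dinatural : ∀ {A A'} {a : Hom (Sig₀ A) A} {a' : Hom (Sig₀ A') A'} {h : Hom A A'}
                       {c : Hom μSig (B₀ A A)} {c' : Hom μSig (B₀ A' A')} →
                     IsHom a a' h → IsClub law a c → IsClub law a' c' →
                     B₁ id h ∘ c ≈ B₁ h id ∘ c'
    club-dinatural {A} {A'} {a} {a'} {h} {c} {c'} hom-h club-c club-c' =
      ≈-trans (para-unique left) (≈-sym (para-unique right))
      where
      ρA  = ρ A (a ∘ inl) A
      ρA' = ρ A (a ∘ inl) A'
      ρ'  = ρ A' (a' ∘ inl) A'

      left : (B₁ id h ∘ c) ∘ ι ≈ clubStep a a' h ∘ Sig₁ ⟨ fold a , B₁ id h ∘ c ⟩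
      left = begin
        (B₁ id h ∘ c) ∘ ι
          ≈⟨ pullʳ (≈-trans club-c (≈-trans (≈-sym club-step) assoc)) ⟩
        B₁ id h ∘ B₁ id (extSig a ∇) ∘ ρA ∘ Sig₁ ⟨ fold a , c ⟩
          ≈⟨ pullˡ (B-merge identityˡ (≈-trans (hom-∘-extSig hom-h) (extSig-cong h∘∇))) ⟩
        B₁ id (extSig a' ([ h , id ] ∘ (id +₁ h))) ∘ ρA ∘ Sig₁ ⟨ fold a , c ⟩
          ≈⟨ ∘-congʳ (B-merge identityˡ extSig-∘-Sig⋆₁) ⟨
        (B₁ id (extSig a' [ h , id ]) ∘ B₁ id (Sig⋆₁ (id +₁ h))) ∘ ρA ∘ Sig₁ ⟨ fold a , c ⟩
          -- Naturality carries `h` through the law, so that it acts on the recursive result `c`.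
          ≈⟨ pullʳ (pullˡ (natural h)) ⟩
        B₁ id (extSig a' [ h , id ]) ∘ (ρA' ∘ Sig₁ (id ×₁ B₁ id h)) ∘ Sig₁ ⟨ fold a , c ⟩
          ≈⟨ ∘-congˡ (pullʳ (≈-trans Sig₁-∘ (Sig₁-cong (≈-trans ×₁-⟨⟩ (⟨⟩-cong identityˡ ≈-refl))))) ⟩
        B₁ id (extSig a' [ h , id ]) ∘ ρA' ∘ Sig₁ ⟨ fold a , B₁ id h ∘ c ⟩
          ≈⟨ assoc ⟨
        clubStep a a' h ∘ Sig₁ ⟨ fold a , B₁ id h ∘ c ⟩ ∎
        where
        h∘∇ : h ∘ ∇ ≈ [ h , id ] ∘ (id +₁ h)
        h∘∇ = ≈-trans ∘-[] (≈-trans ([]-cong ≈-refl (≈-trans identityʳ (≈-sym identityˡ))) (≈-sym []-+₁))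

      right : (B₁ h id ∘ c') ∘ ι ≈ clubStep a a' h ∘ Sig₁ ⟨ fold a , B₁ h id ∘ c' ⟩
      right = begin
        (B₁ h id ∘ c') ∘ ι
          ≈⟨ pullʳ (≈-trans club-c' (≈-trans (≈-sym club-step) assoc)) ⟩
        B₁ h id ∘ B₁ id (extSig a' ∇) ∘ ρ' ∘ Sig₁ ⟨ fold a' , c' ⟩
          ≈⟨ pullˡ (B-merge identityˡ identityˡ) ⟩
        B₁ h (extSig a' ∇) ∘ ρ' ∘ Sig₁ ⟨ fold a' , c' ⟩
          ≈⟨ ∘-congʳ (B-merge identityʳ identityʳ) ⟨
        (B₁ id (extSig a' ∇) ∘ B₁ h id) ∘ ρ' ∘ Sig₁ ⟨ fold a' , c' ⟩
          ≈⟨ pullʳ (∘-congˡ (∘-congˡ fold')) ⟩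
        B₁ id (extSig a' ∇) ∘ B₁ h id ∘ ρ' ∘ Sig₁ (h ×₁ id) ∘ Sig₁ ⟨ fold a , c' ⟩
          ≈⟨ ∘-congˡ (≈-trans (∘-congˡ (≈-sym assoc)) (pullˡ (≈-sym (dinatural h (hom-inl hom-h))))) ⟩
        B₁ id (extSig a' ∇) ∘ (B₁ id (Sig⋆₁ (h +₁ id)) ∘ ρA' ∘ Sig₁ (id ×₁ B₁ h id)) ∘ Sig₁ ⟨ fold a , c' ⟩
          ≈⟨ ∘-congˡ (pullʳ (pullʳ (≈-trans Sig₁-∘ (Sig₁-cong (≈-trans ×₁-⟨⟩ (⟨⟩-cong identityˡ ≈-refl)))))) ⟩
        B₁ id (extSig a' ∇) ∘ B₁ id (Sig⋆₁ (h +₁ id)) ∘ ρA' ∘ Sig₁ ⟨ fold a , B₁ h id ∘ c' ⟩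
          ≈⟨ pullˡ (B-merge identityˡ (≈-trans extSig-∘-Sig⋆₁ (extSig-cong ∇∘h+id))) ⟩
        B₁ id (extSig a' [ h , id ]) ∘ ρA' ∘ Sig₁ ⟨ fold a , B₁ h id ∘ c' ⟩
          ≈⟨ assoc ⟨
        clubStep a a' h ∘ Sig₁ ⟨ fold a , B₁ h id ∘ c' ⟩ ∎
        where
        ∇∘h+id : ∇ ∘ (h +₁ id) ≈ [ h , id ]
        ∇∘h+id = ≈-trans []-+₁ ([]-cong identityˡ identityˡ)

        -- By initiality `fold a'` is `h ∘ fold a`, which gives the argument of the law the factor
        -- `h ×₁ id` needed for dinaturality.
        fold' : Sig₁ ⟨ fold a' , c' ⟩ ≈ Sig₁ (h ×₁ id) ∘ Sig₁ ⟨ fold a , c' ⟩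
        fold' = ≈-sym (≈-trans Sig₁-∘ (Sig₁-cong (≈-trans ×₁-⟨⟩
          (⟨⟩-cong (fold-unique (hom-∘ hom-h fold-hom)) identityˡ))))

    -- `B₀ A A` comes with no algebra structure, but the pairing of `fold a` with `club a` is an
    -- algebra morphism. Composites of it with free extensions are again free extensions, hence
    -- determined by the generators. This is why the folds must be merged along with the clubs.
    club-merges : ∀ {A X} {a : Hom (Sig₀ A) A} {p₁ p₂ : Hom X μSig} →
                  fold a ∘ p₁ ≈ fold a ∘ p₂ → club a ∘ p₁ ≈ club a ∘ p₂ →
                  club a ∘ extSig ι p₁ ≈ club a ∘ extSig ι p₂
    club-merges {A} {X} {a} {p₁} {p₂} fold-merges club-merges = begin
      club a ∘ extSig ι p₁                       ≈⟨ pullʳ (hom-∘-extSig fold-hom) ⟩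
      π₂ ∘ extSig (pairAlg a t) (k ∘ p₁)         ≈⟨ ∘-congˡ (extSig-cong k-merges) ⟩
      π₂ ∘ extSig (pairAlg a t) (k ∘ p₂)         ≈⟨ pullʳ (hom-∘-extSig fold-hom) ⟨
      club a ∘ extSig ι p₂                       ∎
      where
      t = clubStep a a id
      k = fold (pairAlg a t)

      k-∘ : ∀ {p : Hom X μSig} → k ∘ p ≈ ⟨ fold a ∘ p , club a ∘ p ⟩
      k-∘ = ≈-trans (∘-congʳ ⟨fold,para⟩) ⟨⟩-∘

      k-merges : k ∘ p₁ ≈ k ∘ p₂
      k-merges = ≈-trans k-∘ (≈-trans (⟨⟩-cong fold-merges club-merges) (≈-sym k-∘))

  -- Algebra structures on quotients, and the reflexive pair of free extensions.

  quotient-algebra : SigPreservesReflexiveCoequalizers →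
                     ∀ {X A Q} {a : Hom (Sig₀ A) A} {p₁ p₂ : Hom X A} {s : Hom A X} {q : Hom A Q} →
                     p₁ ∘ s ≈ id → p₂ ∘ s ≈ id → IsCoequalizer p₁ p₂ q →
                     q ∘ a ∘ Sig₁ p₁ ≈ q ∘ a ∘ Sig₁ p₂ →
                     Σ[ b ∈ Hom (Sig₀ Q) Q ] IsHom a b q
  quotient-algebra pres p₁s≈id p₂s≈id coeq eq = factor _ eq' , ≈-sym (factor-q eq')
    where
    -- The common section `s` makes the pair reflexive, so `Sig₁ q` is again a coequalizer, and
    -- `q ∘ a` factors through it.
    open IsCoequalizer (pres _ _ _ p₁s≈id p₂s≈id _ coeq)
    eq' = ≈-trans assoc (≈-trans eq (≈-sym assoc))

  -- An algebra endomorphism of the initial algebra is the identity. The section does not depend on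
  -- `p`, so it is shared by the extensions of both projections and makes them a reflexive pair.
  fold-algSig-section : ∀ {X} {p : Hom X μSig} → extSig ι p ∘ fold (algSig X) ≈ id
  fold-algSig-section = ≈-trans (fold-unique (hom-∘ extSig-hom fold-hom)) (≈-sym (fold-unique id-hom))
    where
    id-hom : IsHom ι ι id
    id-hom = ≈-trans identityˡ (≈-sym (≈-trans (∘-congˡ Sig₁-id) identityʳ))
      where
      Sig₁-id : ∀ {Y} → Sig₁ (id {Y}) ≈ id
      Sig₁-id = ≈-sym (Coprod.unique _ (≈-trans identityˡ (≈-sym identityʳ))
        (≈-trans identityˡ (≈-sym (≈-trans (∘-congˡ (Functor.identity Sig')) identityʳ))))

  -- `ι ∘ Sig₁ p` is the restriction of `extSig ι p` to the terms with a single operation applied to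
  -- variables.
  extended-merges : ∀ {X Z} {f : Hom μSig Z} {p₁ p₂ : Hom X μSig} →
                    f ∘ extSig ι p₁ ≈ f ∘ extSig ι p₂ →
                    f ∘ ι ∘ Sig₁ p₁ ≈ f ∘ ι ∘ Sig₁ p₂
  extended-merges {X} {f = f} {p₁} {p₂} eq = begin
    f ∘ ι ∘ Sig₁ p₁                          ≈⟨ ∘-congˡ unfold ⟩
    f ∘ extSig ι p₁ ∘ algSig X ∘ Sig₁ (ηSig X) ≈⟨ pullˡ eq ⟩
    (f ∘ extSig ι p₂) ∘ algSig X ∘ Sig₁ (ηSig X) ≈⟨ assoc ⟩
    f ∘ extSig ι p₂ ∘ algSig X ∘ Sig₁ (ηSig X) ≈⟨ ∘-congˡ unfold ⟨
    f ∘ ι ∘ Sig₁ p₂                          ∎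
    where
    unfold : ∀ {p : Hom X μSig} → ι ∘ Sig₁ p ≈ extSig ι p ∘ algSig X ∘ Sig₁ (ηSig X)
    unfold = ≈-sym (≈-trans (pullˡ extSig-hom) (pullʳ (≈-trans Sig₁-∘ (Sig₁-cong extSig-η))))

  -- Quotients of coalgebras and finality.

  module _ (fin : FinalCoalgebra) where
    open FinalCoalgebra fin

    -- The hypothesis lets `B₁ id q ∘ γ` descend to a coalgebra on `Q` with `q` as a coalgebra
    -- morphism; by finality `coit γ` then factors through `q`.
    coit-merges : ∀ {X A Q} {γ : Hom A (B₀ μSig A)} {p₁ p₂ : Hom X A} {q : Hom A Q} →
                  IsCoequalizer p₁ p₂ q →
                  (B₁ id q ∘ γ) ∘ p₁ ≈ (B₁ id q ∘ γ) ∘ p₂ →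
                  coit γ ∘ p₁ ≈ coit γ ∘ p₂
    coit-merges {γ = γ} {p₁} {p₂} {q} coeq eq = begin
      coit γ ∘ p₁          ≈⟨ ∘-congʳ coit-q ⟨
      (coit β ∘ q) ∘ p₁    ≈⟨ pullʳ commute ⟩
      coit β ∘ q ∘ p₂      ≈⟨ pullˡ coit-q ⟩
      coit γ ∘ p₂          ∎
      where
      open IsCoequalizer coeq
      β = factor _ eq

      coit-q : coit β ∘ q ≈ coit γ
      coit-q = coit-unique _ (begin
        ζ ∘ coit β ∘ q               ≈⟨ pullˡ coit-hom ⟩
        (B₁ id (coit β) ∘ β) ∘ q     ≈⟨ pullʳ (factor-q eq) ⟩
        B₁ id (coit β) ∘ B₁ id q ∘ γ ≈⟨ pullˡ (B-merge identityˡ ≈-refl) ⟩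
        B₁ id (coit β ∘ q) ∘ γ       ∎)

    -- The image inclusion `m` is monic, hence so is `B₁ id m`. After composition with it, both
    -- sides become `ζ ∘ coit γ` applied to the projections, which the kernel pair equates.
    image-bisimulation : IsRegular → BPreservesMonos →
                         ∀ {A E Q} {γ : Hom A (B₀ μSig A)} {p₁ p₂ : Hom E A} {q : Hom A Q} →
                         IsPullback (coit γ) (coit γ) p₁ p₂ → IsCoequalizer p₁ p₂ q →
                         B₁ id q ∘ γ ∘ p₁ ≈ B₁ id q ∘ γ ∘ p₂
    image-bisimulation regular presMono {γ = γ} {p₁} {p₂} {q} kp coeq =
      presMono id m (λ _ _ eq → ≈-trans (≈-sym identityʳ) (≈-trans eq identityʳ))
        (image-mono lim regular kp coeq m∘q) _ _ (begin
          B₁ id m ∘ B₁ id q ∘ γ ∘ p₁ ≈⟨ unfold ⟩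
          ζ ∘ coit γ ∘ p₁            ≈⟨ ∘-congˡ (IsPullback.commute kp) ⟩
          ζ ∘ coit γ ∘ p₂            ≈⟨ unfold ⟨
          B₁ id m ∘ B₁ id q ∘ γ ∘ p₂ ∎)
      where
      open IsCoequalizer coeq
      m = factor (coit γ) (IsPullback.commute kp)

      m∘q : m ∘ q ≈ coit γ
      m∘q = factor-q (IsPullback.commute kp)

      unfold : ∀ {p} → B₁ id m ∘ B₁ id q ∘ γ ∘ p ≈ ζ ∘ coit γ ∘ p
      unfold {p} = begin
        B₁ id m ∘ B₁ id q ∘ γ ∘ p  ≈⟨ pullˡ (B-merge identityˡ m∘q) ⟩
        B₁ id (coit γ) ∘ γ ∘ p     ≈⟨ pullˡ (≈-sym coit-hom) ⟩
        (ζ ∘ coit γ) ∘ p           ≈⟨ assoc ⟩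
        ζ ∘ coit γ ∘ p             ∎

-- Congruence of the behavioural kernel pair.

theorem4p12 : ∀ {o ℓ e} (C : Category o ℓ e)
    (lim : Notions.FiniteLimits C) (colim : Notions.FiniteColimits C)
    (regular : Notions.IsRegular C)
    (V : Category.Obj C) (Sig' : Functor C)
    (free' : Notions.FreeAlgebras C (Functor.F₀ Sig') (Functor.F₁ Sig'))
    (B : Bifunctor C) →
    let open Setting C lim colim V Sig' free' B in
    (law : GSOSLaw) →
    SigPreservesReflexiveCoequalizers →
    BPreservesMonos →
    (fin : FinalCoalgebra) →
    (c : Category.Hom C μSig (Bifunctor.B₀ B μSig μSig)) →
    IsOperationalModel law c →
    KernelPairIsCongruence (FinalCoalgebra.coit fin c)
theorem4p12 C lim colim regular V Sig' free' B law presCoeq presMono fin c opModel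
            {E} p₁ p₂ kp {Q₀} q₀ coeq₀ =
  -- The diagonal makes the kernel pair reflexive, so it remains to show that `q₀` merges the two
  -- composites with `ι`.
  quotient-algebra presCoeq p₁∘diagonal p₂∘diagonal coeq₀ q₀-merges-ι
  where
  open Category C
  open Notions C
  open CategoryLemmas C
  open ≈-Reasoning
  open Setting C lim colim V Sig' free' B
  open SettingLemmas C lim colim V Sig' free' B
  open ClubLemmas law
  open Bifunctor B using (B₁)
  open FinalCoalgebra fin using (coit)
  open Diagonal kp

  p̂₁ p̂₂ : Hom (Sig⋆ E) μSig
  p̂₁ = extSig ι p₁
  p̂₂ = extSig ι p₂

  open Coequalizer (FiniteColimits.coequalizer colim p̂₁ p̂₂) renaming (isCoequalizer to coeq)

  q-algebra : Σ[ a ∈ Hom (Sig₀ Q) Q ] IsHom ι a q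
  q-algebra = quotient-algebra presCoeq fold-algSig-section fold-algSig-section coeq (begin
    q ∘ ι ∘ Sig₁ p̂₁          ≈⟨ ∘-congˡ extSig-hom ⟨
    q ∘ p̂₁ ∘ algSig E        ≈⟨ pullˡ (IsCoequalizer.commute coeq) ⟩
    (q ∘ p̂₂) ∘ algSig E      ≈⟨ pullʳ extSig-hom ⟩
    q ∘ ι ∘ Sig₁ p̂₂          ∎)

  a : Hom (Sig₀ Q) Q
  a = proj₁ q-algebra

  q-merges : q ∘ p₁ ≈ q ∘ p₂
  q-merges = begin
    q ∘ p₁               ≈⟨ ∘-congˡ extSig-η ⟨
    q ∘ p̂₁ ∘ ηSig E      ≈⟨ pullˡ (IsCoequalizer.commute coeq) ⟩
    (q ∘ p̂₂) ∘ ηSig E    ≈⟨ pullʳ extSig-η ⟩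
    q ∘ p₂               ∎

  -- `Q₀` embeds into the final coalgebra but has no algebra structure yet, whereas `Q` has the
  -- algebra but no evident embedding. The map `r` carries the bisimulation property from `q₀` over
  -- to the coarser `q`.
  r : Hom Q₀ Q
  r = IsCoequalizer.factor coeq₀ q q-merges

  Bq-split : ∀ {X} {p : Hom X μSig} → B₁ id r ∘ B₁ id q₀ ∘ c ∘ p ≈ B₁ id q ∘ c ∘ p
  Bq-split = pullˡ (B-merge identityˡ (IsCoequalizer.factor-q coeq₀ q-merges))

  fold-merges : fold a ∘ p₁ ≈ fold a ∘ p₂
  fold-merges = begin
    fold a ∘ p₁    ≈⟨ ∘-congʳ (fold-unique (proj₂ q-algebra)) ⟨
    q ∘ p₁         ≈⟨ q-merges ⟩
    q ∘ p₂         ≈⟨ ∘-congʳ (fold-unique (proj₂ q-algebra)) ⟩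
    fold a ∘ p₂    ∎

  transfer : B₁ id q ∘ c ≈ B₁ q id ∘ club a
  transfer = club-dinatural (proj₂ q-algebra) opModel (club-isClub a)

  club-merges-kernel : club a ∘ p₁ ≈ club a ∘ p₂
  -- In its contravariant argument `B` turns the epimorphism `q` into a monomorphism, so `B₁ q id`
  -- can be cancelled.
  club-merges-kernel = presMono q id (coequalizer-epi coeq)
    (λ _ _ eq → ≈-trans (≈-sym identityˡ) (≈-trans eq identityˡ)) _ _ (begin
      B₁ q id ∘ club a ∘ p₁            ≈⟨ pullˡ (≈-sym transfer) ⟩
      (B₁ id q ∘ c) ∘ p₁               ≈⟨ assoc ⟩
      B₁ id q ∘ c ∘ p₁                 ≈⟨ Bq-split ⟨
      B₁ id r ∘ B₁ id q₀ ∘ c ∘ p₁      ≈⟨ ∘-congˡ (image-bisimulation fin regular presMono kp coeq₀) ⟩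
      B₁ id r ∘ B₁ id q₀ ∘ c ∘ p₂      ≈⟨ Bq-split ⟩
      B₁ id q ∘ c ∘ p₂                 ≈⟨ assoc ⟨
      (B₁ id q ∘ c) ∘ p₂               ≈⟨ ∘-congʳ transfer ⟩
      (B₁ q id ∘ club a) ∘ p₂          ≈⟨ assoc ⟩
      B₁ q id ∘ club a ∘ p₂            ∎)

  coit-merges-p̂ : coit c ∘ p̂₁ ≈ coit c ∘ p̂₂
  coit-merges-p̂ = coit-merges fin coeq (begin
    (B₁ id q ∘ c) ∘ p̂₁         ≈⟨ ∘-congʳ transfer ⟩
    (B₁ q id ∘ club a) ∘ p̂₁    ≈⟨ pullʳ (club-merges fold-merges club-merges-kernel) ⟩
    B₁ q id ∘ club a ∘ p̂₂      ≈⟨ pullˡ (≈-sym transfer) ⟩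
    (B₁ id q ∘ c) ∘ p̂₂         ∎)

  q₀-merges-ι : q₀ ∘ ι ∘ Sig₁ p₁ ≈ q₀ ∘ ι ∘ Sig₁ p₂
  q₀-merges-ι = begin
    q₀ ∘ ι ∘ Sig₁ p₁    ≈⟨ ∘-congˡ (IsPullback.factor-p₁ kp f-merges-ι) ⟨
    q₀ ∘ p₁ ∘ u         ≈⟨ pullˡ (IsCoequalizer.commute coeq₀) ⟩
    (q₀ ∘ p₂) ∘ u       ≈⟨ pullʳ (IsPullback.factor-p₂ kp f-merges-ι) ⟩
    q₀ ∘ ι ∘ Sig₁ p₂    ∎
    where
    f-merges-ι = extended-merges coit-merges-p̂
    -- The map `u` is an action of `Sig₀` on `E`, compatible with `ι` along both projections.
    u = IsPullback.factor kp _ _ f-merges-ι
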